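{- Let $n \ge 3$ be an integer and let $1 \le r < \lfloor \frac{n}{2} \rfloor$. Then the graph $(C_n^{(r)})^c$ is non-singular if and only if $\gcd(n, 2r+1) = 1$.
   Context: A graph is called non-singular if its adjacency matrix is non-singular. $C_n$ denotes the cycle graph on $n$ vertices. For $1 \le r < \lfloor n/2 \rfloor$, $C_n^{(r)}$ is the graph with the same vertex set as $C_n$ in which two distinct vertices $x,y$ are adjacent exactly when the length of a shortest path from $x$ to $y$ in $C_n$ is at most $r$. The complement $X^c$ of a graph $X$ has the same vertex set, and two distinct vertices are adjacent in $X^c$ exactly when they are not adjacent in $X$ (no loops). -}

module Defs where

open import Data.Bool.Base using (if_then_else_)
open import Data.Fin.Base using (Fin; zero; suc; toℕ; fromℕ; inject₁; opposite)
open import Data.Fin.Properties as Fin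
  using (all?; any?; opposite-involutive)
open import Data.Nat.Base using (ℕ; zero; suc; _≤_; _<_; z≤n; s≤s)
open import Data.Nat.Properties as ℕ
  using (≮⇒≥; <⇒≱; anyUpTo?; allUpTo?)
open import Data.Product.Base using (∃; ∃-syntax; _×_; _,_)
open import Data.Rational.Base using (ℚ; 0ℚ; 1ℚ; _*_)
open import Data.Rational.Properties using (+-0-monoid)
open import Data.Sum.Base using (_⊎_; inj₁; inj₂; swap)
open import Data.Vec.Functional using (_∷_)
open import Function.Base using (_∘_)
open import Function.Definitions using (Injective)
open import Relation.Binary.Definitions using (Decidable; Symmetric)
open import Relation.Binary.PropositionalEquality
  using (_≡_; _≢_; _≗_; refl; sym; trans; cong; subst; subst₂; ≢-sym)
open import Relation.Nullary.Decidable
  using (Dec; does; map′; ¬?; _×-dec_; _⊎-dec_; _→-dec_)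
open import Relation.Nullary.Negation using (¬_)

import Algebra.Properties.Monoid.Sum as MonoidSum
open MonoidSum +-0-monoid using (sum)

-- Finite simple graphs.  Decidability of adjacency is what makes the
-- 0/1 adjacency matrix definable constructively.

record Graph (n : ℕ) : Set₁ where
  field
    Adj    : Fin n → Fin n → Set
    adj?   : Decidable Adj
    symm   : Symmetric Adj
    irrefl : ∀ {x} → ¬ Adj x x

record Path {n} (G : Graph n) (x y : Fin n) (k : ℕ) : Set where
  open Graph G
  field
    vertex   : Fin (suc k) → Fin n
    start    : vertex zero ≡ x
    end      : vertex (fromℕ k) ≡ y
    step     : ∀ (i : Fin k) → Adj (vertex (inject₁ i)) (vertex (suc i))
    distinct : Injective _≡_ _≡_ vertex

IsShortestPathLength : ∀ {n} → Graph n → Fin n → Fin n → ℕ → Set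
IsShortestPathLength G x y d = Path G x y d × (∀ k → Path G x y k → d ≤ k)

reverse : ∀ {n} {G : Graph n} {x y k} → Path G x y k → Path G y x k
reverse {G = G} {k = k} p = record
  { vertex   = vertex ∘ opposite
  ; start    = end
  ; end      = trans (cong vertex (opposite-involutive zero)) start
  ; step     = λ i → symm (subst (λ j → Adj (vertex (inject₁ (opposite i))) (vertex j))
                             (sym (opposite-inject₁ i)) (step (opposite i)))
  ; distinct = λ {i} {j} eq → trans (sym (opposite-involutive i))
                 (trans (cong opposite (distinct eq)) (opposite-involutive j))
  }
  where
  open Graph G
  open Path p
  opposite-inject₁ : ∀ {m} (i : Fin m) → opposite (inject₁ i) ≡ suc (opposite i)
  opposite-inject₁ zero    = refl
  opposite-inject₁ (suc i) = cong inject₁ (opposite-inject₁ i)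

anyFunction? : ∀ m {n} {P : (Fin m → Fin n) → Set} →
               (∀ {f g} → f ≗ g → P f → P g) →
               (∀ f → Dec (P f)) → Dec (∃ P)
anyFunction? zero resp P? =
  map′ (λ p → _ , p) (λ (_ , p) → resp (λ ()) p) (P? λ ())
anyFunction? (suc m) {P = P} resp P? =
  map′ (λ (v , f , p) → v ∷ f , p)
       (λ (f , p) → f zero , f ∘ suc ,
                    resp (λ { zero → refl ; (suc _) → refl }) p)
       (any? λ v → anyFunction? m {P = λ f → P (v ∷ f)}
          (λ eq → resp λ { zero → refl ; (suc i) → eq i })
          (λ f → P? (v ∷ f)))

path? : ∀ {n} (G : Graph n) x y k → Dec (Path G x y k)
path? {n} G x y k =
  map′ (λ (f , s , e , t , d) → record
         { vertex = f ; start = s ; end = e ; step = t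
         ; distinct = λ {i} {j} → d i j })
       (λ p → let open Path p in
         vertex , start , end , step , λ i j → distinct)
       (anyFunction? (suc k) resp λ f →
         (f zero Fin.≟ x) ×-dec (f (fromℕ k) Fin.≟ y)
           ×-dec all? (λ i → adj? (f (inject₁ i)) (f (suc i)))
           ×-dec all? (λ i → all? λ j → (f i Fin.≟ f j) →-dec (i Fin.≟ j)))
  where
  open Graph G
  IsPath : (Fin (suc k) → Fin n) → Set
  IsPath f = f zero ≡ x × f (fromℕ k) ≡ y
           × (∀ (i : Fin k) → Adj (f (inject₁ i)) (f (suc i)))
           × (∀ i j → f i ≡ f j → i ≡ j)
  resp : ∀ {f g} → f ≗ g → IsPath f → IsPath g
  resp eq (s , e , t , d) =
      trans (sym (eq _)) s
    , trans (sym (eq _)) e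
    , (λ i → subst₂ Adj (eq _) (eq _) (t i))
    , (λ i j gi≡gj → d i j (trans (eq i) (trans gi≡gj (sym (eq j)))))

isShortestPathLength? : ∀ {n} (G : Graph n) x y d → Dec (IsShortestPathLength G x y d)
isShortestPathLength? G x y d = path? G x y d ×-dec
  map′ (λ none k p → ≮⇒≥ λ k<d → none k<d p)
       (λ least {k} k<d p → <⇒≱ k<d (least k p))
       (allUpTo? (λ k → ¬? (path? G x y k)) d)

-- X^(r), for an arbitrary graph X.

power : ∀ {n} → Graph n → ℕ → Graph n
power {n} G r = record
  { Adj    = λ x y → x ≢ y × (∃[ d ] d ≤ r × IsShortestPathLength G x y d)
  ; adj?   = λ x y → ¬? (x Fin.≟ y) ×-dec
      map′ (λ { (d , s≤s d≤r , s) → d , d≤r , s })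
           (λ (d , d≤r , s) → d , s≤s d≤r , s)
           (anyUpTo? (isShortestPathLength? G x y) (suc r))
  ; symm   = λ (x≢y , d , d≤r , p , least) →
      ≢-sym x≢y , d , d≤r , reverse p , λ k q → least k (reverse q)
  ; irrefl = λ (x≢x , _) → x≢x refl
  }

complement : ∀ {n} → Graph n → Graph n
complement G = record
  { Adj    = λ x y → x ≢ y × ¬ Adj x y
  ; adj?   = λ x y → ¬? (x Fin.≟ y) ×-dec ¬? (adj? x y)
  ; symm   = λ (x≢y , ¬xy) → ≢-sym x≢y , λ yx → ¬xy (symm yx)
  ; irrefl = λ (x≢x , _) → x≢x refl
  }
  where open Graph G

-- y follows x in the cyclic order 0, 1, …, n - 1, 0.

Next : ∀ {n} → Fin n → Fin n → Set
Next {n} x y = suc (toℕ x) ≡ toℕ y ⊎ (suc (toℕ x) ≡ n × toℕ y ≡ 0)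

next? : ∀ {n} → Decidable (Next {n})
next? {n} x y = (suc (toℕ x) ℕ.≟ toℕ y) ⊎-dec
                ((suc (toℕ x) ℕ.≟ n) ×-dec (toℕ y ℕ.≟ 0))

cycle : ∀ n → 3 ≤ n → Graph n
cycle n n≥3 = record
  { Adj    = λ x y → Next x y ⊎ Next y x
  ; adj?   = λ x y → next? x y ⊎-dec next? y x
  ; symm   = swap
  ; irrefl = λ { (inj₁ x→x) → next-irrefl x→x ; (inj₂ x→x) → next-irrefl x→x }
  }
  where
  next-irrefl : ∀ {x : Fin n} → ¬ Next x x
  next-irrefl (inj₁ eq) = ℕ.1+n≢n eq
  next-irrefl (inj₂ (1+x≡n , x≡0)) =
    <⇒≱ (s≤s (s≤s z≤n)) (subst (3 ≤_) (trans (sym 1+x≡n) (cong suc x≡0)) n≥3)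

Matrix : ℕ → Set
Matrix n = Fin n → Fin n → ℚ

identity : ∀ {n} → Matrix n
identity i j = if does (i Fin.≟ j) then 1ℚ else 0ℚ

infixl 7 _⊗_
_⊗_ : ∀ {n} → Matrix n → Matrix n → Matrix n
(A ⊗ B) i j = sum λ k → A i k * B k j

-- Matrices are functions, so equality of matrices is taken entrywise.

infix 4 _≋_
_≋_ : ∀ {n} → Matrix n → Matrix n → Set
A ≋ B = ∀ i j → A i j ≡ B i j

NonSingular : ∀ {n} → Matrix n → Set
NonSingular A = ∃[ B ] A ⊗ B ≋ identity × B ⊗ A ≋ identity

adjacencyMatrix : ∀ {n} → Graph n → Matrix n
adjacencyMatrix G x y = if does (adj? x y) then 1ℚ else 0ℚ
  where open Graph G

NonSingularGraph : ∀ {n} → Graph n → Set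
NonSingularGraph G = NonSingular (adjacencyMatrix G)

{-# OPTIONS --safe #-}
module Submission where

-- Two vertices are adjacent in the complement exactly when their cyclic difference is one of
-- the m = n - (2r + 1) values r + 1, …, n - r - 1.  On functions g of period n the adjacency
-- matrix is therefore a window sum: (A g)(x) = ∑_{i < m} g(x + r + 1 + i).
--
-- If d divides n and m and χ is the indicator of d ∣ x, then g(x) = χ(x) - χ(x + 1) has period n
-- and its window sums telescope to 0; so A invertible forces g(0) = 0, that is, d ∣ 1.
--
-- If a m = 1 + b n, then a consecutive windows cover Z/n exactly b times and one point once more:
-- summing the point mass at y + r + 1 over the shifts by t m (t < a) gives a vector sent by A to
-- the point mass at y plus the constant b.  A multiple of the all-ones vector, which A scales
-- by m, corrects the constant and yields the column y of an inverse.

open import Defs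
open import Data.Nat.Base using (ℕ; _≤_; _<_; _+_; _*_; ⌊_/2⌋)
open import Data.Nat.GCD using (gcd)
open import Function.Bundles using (_⇔_)
open import Relation.Binary.PropositionalEquality using (_≡_)

open import Algebra.Bundles using (module CommutativeRing)
open import Data.Bool.Base using (if_then_else_)
open import Data.Fin.Base using (Fin; zero; suc; toℕ; fromℕ; inject₁)
open import Data.Fin.Properties as Fin using (toℕ<n; toℕ-injective; toℕ-fromℕ; toℕ-fromℕ<; toℕ-inject₁)
open import Data.Nat.Base using (zero; suc; pred; _∸_; NonZero; >-nonZero; z≤n; s≤s)
open import Data.Nat.Coprimality using (Coprime; coprime-Bézout; gcd≡1⇒coprime)
open import Data.Nat.Divisibility using (_∣_; _∣?_; divides; _∣0; ∣1⇒≡1; ∣m+n∣m⇒∣n; ∣m∣n⇒∣m+n)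
open import Data.Nat.DivMod
  using (_%_; _mod_; %-distribˡ-+; m<n⇒m%n≡m; m%n<n; m%n%n≡m%n; n%n≡0; m*n%n≡0; [m+n]%n≡m%n; [m+kn]%n≡m%n)
open import Data.Nat.GCD using (gcd[m,n]∣m; gcd[m,n]∣n; module Bézout)
open import Data.Nat.Induction using (<-rec)
import Data.Nat.Properties as ℕ
open import Data.Product.Base using (∃-syntax; _×_; _,_; proj₁; proj₂)
open import Data.Rational.Base as ℚ using (ℚ; 0ℚ; 1ℚ; Positive; NonNegative)
  renaming (_+_ to _+ℚ_; _*_ to _*ℚ_; _-_ to _-ℚ_; -_ to -ℚ_)
import Data.Rational.Properties as ℚ
open import Data.Sum.Base using (inj₁; inj₂)
open import Function.Base using (_∘_; flip)
open import Function.Bundles using (mk⇔)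
open import Relation.Binary.PropositionalEquality
  using (_≗_; refl; sym; trans; cong; cong₂; subst; subst₂; module ≡-Reasoning)
open import Relation.Nullary.Decidable using (Dec; yes; no; does; dec-true; dec-false; does-⇔; _×-dec_)
open import Relation.Nullary.Negation using (¬_; contradiction)

open import Algebra.Properties.CommutativeSemigroup ℕ.+-commutativeSemigroup using (x∙yz≈y∙xz; xy∙z≈xz∙y)
open import Algebra.Properties.Group ℚ.+-0-group using (∙-cancelʳ)
open import Algebra.Properties.Semiring.Mult (CommutativeRing.semiring ℚ.+-*-commutativeRing)
  using (×-assoc-*) renaming (_×_ to _×ℚ_)
open import Algebra.Properties.Semiring.Sum (CommutativeRing.semiring ℚ.+-*-commutativeRing)
  using (sum; sum-cong-≗; sum-replicate; sum-replicate-zero; *-distribˡ-sum; *-distribʳ-sum; ∑-comm; ∑-distrib-+)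

-- Matrices acting on vectors, and one-sided inverses.

infixr 7 _∙_
_∙_ : ∀ {n} → Matrix n → (Fin n → ℚ) → Fin n → ℚ
(A ∙ v) i = sum λ k → A i k *ℚ v k

∙-congʳ : ∀ {n} (A : Matrix n) {v w} → v ≗ w → A ∙ v ≗ A ∙ w
∙-congʳ A v≗w i = sum-cong-≗ λ k → cong (A i k *ℚ_) (v≗w k)

∙-congˡ : ∀ {n} {A B : Matrix n} v → A ≋ B → A ∙ v ≗ B ∙ v
∙-congˡ v A≋B i = sum-cong-≗ λ k → cong (_*ℚ v k) (A≋B i k)

∙-assoc : ∀ {n} (A B : Matrix n) v → (A ⊗ B) ∙ v ≗ A ∙ B ∙ v
∙-assoc {n} A B v i = begin
  sum (λ k → sum (λ l → A i l *ℚ B l k) *ℚ v k)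
    ≡⟨ sum-cong-≗ (λ k → *-distribʳ-sum (v k) (λ l → A i l *ℚ B l k)) ⟩
  sum (λ k → sum (λ l → A i l *ℚ B l k *ℚ v k))
    ≡⟨ ∑-comm (λ k l → A i l *ℚ B l k *ℚ v k) ⟩
  sum (λ l → sum (λ k → A i l *ℚ B l k *ℚ v k))
    ≡⟨ sum-cong-≗ (λ l → sum-cong-≗ λ k → ℚ.*-assoc (A i l) (B l k) (v k)) ⟩
  sum (λ l → sum (λ k → A i l *ℚ (B l k *ℚ v k)))
    ≡⟨ sum-cong-≗ (λ l → *-distribˡ-sum (A i l) (λ k → B l k *ℚ v k)) ⟨
  sum (λ l → A i l *ℚ sum (λ k → B l k *ℚ v k)) ∎
  where open ≡-Reasoning

sum-zero : ∀ {n} {f : Fin n → ℚ} → (∀ i → f i ≡ 0ℚ) → sum f ≡ 0ℚ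
sum-zero {n} f≗0 = trans (sum-cong-≗ f≗0) (sum-replicate-zero n)

∙-zero : ∀ {n} (A : Matrix n) {v} → (∀ k → v k ≡ 0ℚ) → ∀ i → (A ∙ v) i ≡ 0ℚ
∙-zero A v≗0 i = sum-zero λ k → trans (cong (A i k *ℚ_) (v≗0 k)) (ℚ.*-zeroʳ (A i k))

identity-∙ : ∀ {n} (v : Fin n → ℚ) → identity ∙ v ≗ v
identity-∙ {suc n} v zero = begin
  1ℚ *ℚ v zero +ℚ sum (λ k → 0ℚ *ℚ v (suc k))
    ≡⟨ cong₂ _+ℚ_ (ℚ.*-identityˡ (v zero)) (sum-zero λ k → ℚ.*-zeroˡ (v (suc k))) ⟩
  v zero +ℚ 0ℚ  ≡⟨ ℚ.+-identityʳ (v zero) ⟩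
  v zero        ∎
  where open ≡-Reasoning
identity-∙ {suc n} v (suc i) = begin
  0ℚ *ℚ v zero +ℚ (identity ∙ (v ∘ suc)) i
    ≡⟨ cong₂ _+ℚ_ (ℚ.*-zeroˡ (v zero)) (identity-∙ (v ∘ suc) i) ⟩
  0ℚ +ℚ v (suc i)  ≡⟨ ℚ.+-identityˡ (v (suc i)) ⟩
  v (suc i)        ∎
  where open ≡-Reasoning

identity-symmetric : ∀ {n} (i j : Fin n) → identity i j ≡ identity j i
identity-symmetric i j =
  cong (if_then 1ℚ else 0ℚ) (does-⇔ (mk⇔ sym sym) (i Fin.≟ j) (j Fin.≟ i))

left-inverse⇒trivial-kernel : ∀ {n} {A B : Matrix n} → B ⊗ A ≋ identity →
  ∀ {v} → (∀ i → (A ∙ v) i ≡ 0ℚ) → ∀ i → v i ≡ 0ℚ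
left-inverse⇒trivial-kernel {A = A} {B} BA≋I {v} Av≗0 i = begin
  v i               ≡⟨ identity-∙ v i ⟨
  (identity ∙ v) i  ≡⟨ ∙-congˡ v BA≋I i ⟨
  ((B ⊗ A) ∙ v) i   ≡⟨ ∙-assoc B A v i ⟩
  (B ∙ A ∙ v) i     ≡⟨ ∙-zero B Av≗0 i ⟩
  0ℚ                ∎
  where open ≡-Reasoning

-- Transposing `A ⊗ B ≋ identity` shows that the transpose of `B` is a left inverse of the symmetric
-- `A`. A left and a right inverse coincide, so `B` is symmetric and is itself the left inverse.
symmetric∧right-inverse⇒nonSingular : ∀ {n} {A B : Matrix n} →
  (∀ i j → A i j ≡ A j i) → A ⊗ B ≋ identity → NonSingular A
symmetric∧right-inverse⇒nonSingular {A = A} {B} A-sym AB≋I = B , AB≋I , BA≋I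
  where
  open ≡-Reasoning
  BᵀA≋I : flip B ⊗ A ≋ identity
  BᵀA≋I i j = begin
    sum (λ k → B k i *ℚ A k j)
      ≡⟨ sum-cong-≗ (λ k → trans (ℚ.*-comm (B k i) (A k j)) (cong (_*ℚ B k i) (A-sym k j))) ⟩
    (A ⊗ B) j i   ≡⟨ AB≋I j i ⟩
    identity j i  ≡⟨ identity-symmetric j i ⟩
    identity i j  ∎
  B-sym : ∀ i j → B i j ≡ B j i
  B-sym i j = begin
    B i j                         ≡⟨ identity-∙ (flip B j) i ⟨
    (identity ∙ flip B j) i       ≡⟨ ∙-congˡ (flip B j) BᵀA≋I i ⟨
    ((flip B ⊗ A) ∙ flip B j) i   ≡⟨ ∙-assoc (flip B) A (flip B j) i ⟩
    (flip B ∙ (A ∙ flip B j)) i   ≡⟨ ∙-congʳ (flip B) (λ k → trans (AB≋I k j) (identity-symmetric k j)) i ⟩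
    (flip B ∙ identity j) i       ≡⟨ sum-cong-≗ (λ k → ℚ.*-comm (B k i) (identity j k)) ⟩
    (identity ∙ flip B i) j       ≡⟨ identity-∙ (flip B i) j ⟩
    B j i                         ∎
  BA≋I : B ⊗ A ≋ identity
  BA≋I i j = trans (sum-cong-≗ λ k → cong (_*ℚ A k j) (B-sym i k)) (BᵀA≋I i j)

-- Sums over initial segments of ℕ and periodic functions.

∑< : ℕ → (ℕ → ℚ) → ℚ
∑< n f = sum {n} (f ∘ toℕ)

∑<-cong : ∀ n {f g : ℕ → ℚ} → (∀ {i} → i < n → f i ≡ g i) → ∑< n f ≡ ∑< n g
∑<-cong n f≗g = sum-cong-≗ λ i → f≗g (toℕ<n i)

∑<-zero : ∀ n {f} → (∀ {i} → i < n → f i ≡ 0ℚ) → ∑< n f ≡ 0ℚ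
∑<-zero n f≗0 = sum-zero {n} λ i → f≗0 (toℕ<n i)

∑<-split : ∀ m n f → ∑< (m + n) f ≡ ∑< m f +ℚ ∑< n (f ∘ (m +_))
∑<-split zero    n f = sym (ℚ.+-identityˡ (∑< n f))
∑<-split (suc m) n f = trans (cong (f 0 +ℚ_) (∑<-split m n (f ∘ suc)))
  (sym (ℚ.+-assoc (f 0) (∑< m (f ∘ suc)) (∑< n (f ∘ (suc m +_)))))

∑<-blocks : ∀ a m f → ∑< (a * m) f ≡ ∑< a λ t → ∑< m λ i → f (i + t * m)
∑<-blocks zero    m f = refl
∑<-blocks (suc a) m f = begin
  ∑< (m + a * m) f
    ≡⟨ ∑<-split m (a * m) f ⟩
  ∑< m f +ℚ ∑< (a * m) (f ∘ (m +_))
    ≡⟨ cong₂ _+ℚ_ (∑<-cong m λ {i} _ → cong f (sym (ℕ.+-identityʳ i))) (∑<-blocks a m (f ∘ (m +_))) ⟩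
  ∑< m (λ i → f (i + 0)) +ℚ (∑< a λ t → ∑< m λ i → f (m + (i + t * m)))
    ≡⟨ cong (∑< m (λ i → f (i + 0)) +ℚ_) (∑<-cong a λ {t} _ → ∑<-cong m λ {i} _ → cong f (x∙yz≈y∙xz m i (t * m))) ⟩
  ∑< m (λ i → f (i + 0)) +ℚ (∑< a λ t → ∑< m λ i → f (i + (m + t * m))) ∎
  where
  open ≡-Reasoning

∑<-comm : ∀ m n (f : ℕ → ℕ → ℚ) → ∑< m (λ i → ∑< n (f i)) ≡ ∑< n λ j → ∑< m λ i → f i j
∑<-comm m n f = ∑-comm {m} {n} λ i j → f (toℕ i) (toℕ j)

∑<-snoc : ∀ n f → ∑< (suc n) f ≡ ∑< n f +ℚ f n
∑<-snoc zero    f = ℚ.+-comm (f 0) 0ℚ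
∑<-snoc (suc n) f = trans (cong (f 0 +ℚ_) (∑<-snoc n (f ∘ suc)))
  (sym (ℚ.+-assoc (f 0) (∑< n (f ∘ suc)) (f (suc n))))

∑<-telescope : ∀ n (f : ℕ → ℚ) → ∑< n (λ i → f i -ℚ f (suc i)) ≡ f 0 -ℚ f n
∑<-telescope zero    f = sym (ℚ.+-inverseʳ (f 0))
∑<-telescope (suc n) f = begin
  f 0 -ℚ f 1 +ℚ ∑< n (λ i → f (suc i) -ℚ f (suc (suc i)))
    ≡⟨ cong (f 0 -ℚ f 1 +ℚ_) (∑<-telescope n (f ∘ suc)) ⟩
  f 0 -ℚ f 1 +ℚ (f 1 -ℚ f (suc n))
    ≡⟨ ℚ.+-assoc (f 0) (-ℚ f 1) (f 1 -ℚ f (suc n)) ⟩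
  f 0 +ℚ (-ℚ f 1 +ℚ (f 1 -ℚ f (suc n)))
    ≡⟨ cong (f 0 +ℚ_) (ℚ.+-assoc (-ℚ f 1) (f 1) (-ℚ f (suc n))) ⟨
  f 0 +ℚ (-ℚ f 1 +ℚ f 1 -ℚ f (suc n))
    ≡⟨ cong (λ z → f 0 +ℚ (z -ℚ f (suc n))) (ℚ.+-inverseˡ (f 1)) ⟩
  f 0 +ℚ (0ℚ -ℚ f (suc n))
    ≡⟨ cong (f 0 +ℚ_) (ℚ.+-identityˡ (-ℚ f (suc n))) ⟩
  f 0 -ℚ f (suc n) ∎
  where open ≡-Reasoning

Periodic : ℕ → (ℕ → ℚ) → Set
Periodic n f = ∀ i → f (i + n) ≡ f i

-- This allows a row of the adjacency matrix to be summed by cyclic difference from `x` instead of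
-- by column.
∑<-shift : ∀ {n f} → Periodic n f → ∀ x → ∑< n (f ∘ (x +_)) ≡ ∑< n f
∑<-shift         per zero    = refl
∑<-shift {n} {f} per (suc x) = trans (sym ∑<-step) (∑<-shift per x)
  where
  open ≡-Reasoning
  g = f ∘ (x +_)
  ∑<-step : ∑< n g ≡ ∑< n (f ∘ (suc x +_))
  -- With `g 0` added, both sides are `∑< (suc n) g`: on the left periodicity makes it the last term
  -- `g n`, on the right it is the first term.
  ∑<-step = ∙-cancelʳ (g 0) _ _ (begin
    ∑< n g +ℚ g 0            ≡⟨ cong (∑< n g +ℚ_) (trans (cong f (ℕ.+-identityʳ x)) (sym (per x))) ⟩
    ∑< n g +ℚ g n            ≡⟨ ∑<-snoc n g ⟨
    g 0 +ℚ ∑< n (g ∘ suc)    ≡⟨ ℚ.+-comm (g 0) (∑< n (g ∘ suc)) ⟩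
    ∑< n (g ∘ suc) +ℚ g 0    ≡⟨ cong (_+ℚ g 0) (∑<-cong n λ {i} _ → cong f (ℕ.+-suc x i)) ⟩
    ∑< n (f ∘ (suc x +_)) +ℚ g 0 ∎)

-- Indicators and natural multiples of rationals.

indicator : ∀ {P : Set} → Dec P → ℚ
indicator P? = if does P? then 1ℚ else 0ℚ

indicator-true : ∀ {P : Set} (P? : Dec P) → P → indicator P? ≡ 1ℚ
indicator-true P? p = cong (if_then 1ℚ else 0ℚ) (dec-true P? p)

indicator-false : ∀ {P : Set} (P? : Dec P) → ¬ P → indicator P? ≡ 0ℚ
indicator-false P? ¬p = cong (if_then 1ℚ else 0ℚ) (dec-false P? ¬p)

indicator-⇔ : ∀ {P Q : Set} → P ⇔ Q → (P? : Dec P) (Q? : Dec Q) → indicator P? ≡ indicator Q?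
indicator-⇔ P⇔Q P? Q? = cong (if_then 1ℚ else 0ℚ) (does-⇔ P⇔Q P? Q?)

×ℚ-nonNegative : ∀ m → NonNegative (m ×ℚ 1ℚ)
×ℚ-nonNegative zero    = _
×ℚ-nonNegative (suc m) = ℚ.nonNeg+nonNeg⇒nonNeg 1ℚ (m ×ℚ 1ℚ) {{×ℚ-nonNegative m}}

-- Finds the constant vector whose window sums of length `m` take a prescribed value.
×ℚ-divisible : ∀ m .{{_ : NonZero m}} q → ∃[ c ] m ×ℚ c ≡ q
×ℚ-divisible m@(suc k) q = ℚ.1/ M *ℚ q , (begin
  m ×ℚ (ℚ.1/ M *ℚ q)          ≡⟨ cong (m ×ℚ_) (ℚ.*-identityˡ (ℚ.1/ M *ℚ q)) ⟨
  m ×ℚ (1ℚ *ℚ (ℚ.1/ M *ℚ q))  ≡⟨ ×-assoc-* m 1ℚ (ℚ.1/ M *ℚ q) ⟨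
  M *ℚ (ℚ.1/ M *ℚ q)          ≡⟨ ℚ.*-assoc M (ℚ.1/ M) q ⟨
  M *ℚ ℚ.1/ M *ℚ q            ≡⟨ cong (_*ℚ q) (ℚ.*-inverseʳ M) ⟩
  1ℚ *ℚ q                     ≡⟨ ℚ.*-identityˡ q ⟩
  q                           ∎)
  where
  open ≡-Reasoning
  M = m ×ℚ 1ℚ
  instance
    M-positive : Positive M
    M-positive = ℚ.pos+nonNeg⇒pos 1ℚ (k ×ℚ 1ℚ) {{×ℚ-nonNegative k}}
    M-nonZero : ℚ.NonZero M
    M-nonZero = ℚ.pos⇒nonZero M

-- Existence of shortest paths.

-- Adjacency in `power` asks for an exact distance, while the arguments below only exhibit some
-- short path. Descent on the length closes the gap, since it is decidable whether a shorter path
-- exists.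
shortest-path : ∀ {n} (G : Graph n) {x y} k → Path G x y k →
  ∃[ d ] d ≤ k × IsShortestPathLength G x y d
shortest-path G {x} {y} = <-rec _ λ k rec p → go k rec p (ℕ.anyUpTo? (path? G x y) k)
  where
  go : ∀ k → (∀ {l} → l < k → Path G x y l → ∃[ d ] d ≤ l × IsShortestPathLength G x y d) →
       Path G x y k → Dec (∃[ l ] l < k × Path G x y l) →
       ∃[ d ] d ≤ k × IsShortestPathLength G x y d
  go k rec p (yes (l , l<k , q)) = let d , d≤l , s = rec l<k q in d , ℕ.≤-trans d≤l (ℕ.<⇒≤ l<k) , s
  go k rec p (no none) = k , ℕ.≤-refl , p , λ l q → ℕ.≮⇒≥ λ l<k → none (l , l<k , q)

-- Residues modulo `n` as vertices of the cycle.

module _ {n : ℕ} .{{_ : NonZero n}} where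

  %-+-congˡ : ∀ {a b} c → a % n ≡ b % n → (c + a) % n ≡ (c + b) % n
  %-+-congˡ {a} {b} c a≡b = begin
    (c + a) % n          ≡⟨ %-distribˡ-+ c a n ⟩
    (c % n + a % n) % n  ≡⟨ cong (λ z → (c % n + z) % n) a≡b ⟩
    (c % n + b % n) % n  ≡⟨ %-distribˡ-+ c b n ⟨
    (c + b) % n          ∎
    where open ≡-Reasoning

  %-+-congʳ : ∀ {a b} c → a % n ≡ b % n → (a + c) % n ≡ (b + c) % n
  %-+-congʳ {a} {b} c a≡b =
    subst₂ (λ s t → s % n ≡ t % n) (ℕ.+-comm c a) (ℕ.+-comm c b) (%-+-congˡ c a≡b)

  -- In place of subtracting `c`, add `c * pred n`, which completes `c` to the multiple `c * n`.
  %-+-cancelˡ : ∀ c {a b} → (c + a) % n ≡ (c + b) % n → a % n ≡ b % n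
  %-+-cancelˡ c {a} {b} eq = begin
    a % n                           ≡⟨ complete a ⟨
    (c * pred n + (c + a)) % n      ≡⟨ %-+-congˡ (c * pred n) eq ⟩
    (c * pred n + (c + b)) % n      ≡⟨ complete b ⟩
    b % n                           ∎
    where
    open ≡-Reasoning
    complete : ∀ a → (c * pred n + (c + a)) % n ≡ a % n
    complete a = begin
      (c * pred n + (c + a)) % n  ≡⟨ cong (_% n) (ℕ.+-assoc (c * pred n) c a) ⟨
      (c * pred n + c + a) % n    ≡⟨ cong (λ z → (z + a) % n) (ℕ.+-comm (c * pred n) c) ⟩
      (c + c * pred n + a) % n    ≡⟨ cong (λ z → (z + a) % n) (ℕ.*-suc c (pred n)) ⟨
      (c * suc (pred n) + a) % n  ≡⟨ cong (λ z → (c * z + a) % n) (ℕ.suc-pred n) ⟩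
      (c * n + a) % n             ≡⟨ cong (_% n) (ℕ.+-comm (c * n) a) ⟩
      (a + c * n) % n             ≡⟨ [m+kn]%n≡m%n a c n ⟩
      a % n                       ∎

  %-injective : ∀ {i j} → i < n → j < n → i % n ≡ j % n → i ≡ j
  %-injective i<n j<n eq = trans (sym (m<n⇒m%n≡m i<n)) (trans eq (m<n⇒m%n≡m j<n))

  toℕ-mod : ∀ i → toℕ (i mod n) ≡ i % n
  toℕ-mod i = toℕ-fromℕ< (m%n<n i n)

  toℕ-mod-% : ∀ i → toℕ (i mod n) % n ≡ i % n
  toℕ-mod-% i = trans (cong (_% n) (toℕ-mod i)) (m%n%n≡m%n i n)

  %⇒mod : ∀ {i j} → i % n ≡ j % n → i mod n ≡ j mod n
  %⇒mod {i} {j} eq = toℕ-injective (trans (toℕ-mod i) (trans eq (sym (toℕ-mod j))))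

  mod⇒% : ∀ {i j} → i mod n ≡ j mod n → i % n ≡ j % n
  mod⇒% {i} {j} eq = trans (sym (toℕ-mod i)) (trans (cong toℕ eq) (toℕ-mod j))

  mod-toℕ : ∀ (x : Fin n) → toℕ x mod n ≡ x
  mod-toℕ x = toℕ-injective (trans (toℕ-mod (toℕ x)) (m<n⇒m%n≡m (toℕ<n x)))

  Next⇒% : ∀ {x y : Fin n} → Next x y → toℕ y % n ≡ suc (toℕ x) % n
  Next⇒% (inj₁ 1+x≡y)         = cong (_% n) (sym 1+x≡y)
  Next⇒% (inj₂ (1+x≡n , y≡0)) = begin
    _ % n  ≡⟨ cong (_% n) y≡0 ⟩
    0 % n  ≡⟨ m*n%n≡0 0 n ⟩
    0      ≡⟨ n%n≡0 n ⟨
    n % n  ≡⟨ cong (_% n) 1+x≡n ⟨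
    _ % n  ∎
    where open ≡-Reasoning

  Next-mod : ∀ i → Next (i mod n) (suc i mod n)
  Next-mod i with suc (i % n) ℕ.<? n
  ... | yes 1+i<n = inj₁ (begin
    suc (toℕ (i mod n))  ≡⟨ cong suc (toℕ-mod i) ⟩
    suc (i % n)          ≡⟨ m<n⇒m%n≡m 1+i<n ⟨
    suc (i % n) % n      ≡⟨ %-+-congˡ 1 (m%n%n≡m%n i n) ⟩
    suc i % n            ≡⟨ toℕ-mod (suc i) ⟨
    toℕ (suc i mod n)    ∎)
    where open ≡-Reasoning
  ... | no 1+i≮n = inj₂ (trans (cong suc (toℕ-mod i)) 1+i≡n , (begin
    toℕ (suc i mod n)    ≡⟨ toℕ-mod (suc i) ⟩
    suc i % n            ≡⟨ %-+-congˡ 1 (m%n%n≡m%n i n) ⟨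
    suc (i % n) % n      ≡⟨ cong (_% n) 1+i≡n ⟩
    n % n                ≡⟨ n%n≡0 n ⟩
    0                    ∎))
    where
    open ≡-Reasoning
    1+i≡n : suc (i % n) ≡ n
    1+i≡n = ℕ.≤-antisym (m%n<n i n) (ℕ.≮⇒≥ 1+i≮n)

  -- Paths in the cycle and adjacency in the complement of its power.

  module _ (n≥3 : 3 ≤ n) where

    -- The path goes `j` steps forward around the cycle; `j < n` keeps it from meeting itself.
    arc : ∀ (x : Fin n) {j} → j < n → Path (cycle n n≥3) x ((toℕ x + j) mod n) j
    arc x {j} j<n = record
      { vertex   = λ i → (toℕ x + toℕ i) mod n
      ; start    = trans (cong (_mod n) (ℕ.+-identityʳ (toℕ x))) (mod-toℕ x)
      ; end      = cong (λ i → (toℕ x + i) mod n) (toℕ-fromℕ j)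
      ; step     = λ i → inj₁ (subst₂ (λ k l → Next (k mod n) (l mod n))
                     (cong (toℕ x +_) (sym (toℕ-inject₁ i))) (sym (ℕ.+-suc (toℕ x) (toℕ i)))
                     (Next-mod (toℕ x + toℕ i)))
      ; distinct = λ {i} {k} eq → toℕ-injective
                     (%-injective (ℕ.<-≤-trans (toℕ<n i) j<n) (ℕ.<-≤-trans (toℕ<n k) j<n)
                       (%-+-cancelˡ (toℕ x) (mod⇒% eq)))
      }

    -- p and q count the steps of the walk in the two directions.
    walk-displacement : ∀ k (f : Fin (suc k) → Fin n) →
      (∀ i → Graph.Adj (cycle n n≥3) (f (inject₁ i)) (f (suc i))) →
      ∃[ p ] ∃[ q ] p + q ≡ k × (toℕ (f (fromℕ k)) + q) % n ≡ (toℕ (f zero) + p) % n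
    walk-displacement zero    f step = 0 , 0 , refl , refl
    walk-displacement (suc k) f step with walk-displacement k (f ∘ suc) (step ∘ suc) | step zero
    ... | p , q , p+q≡k , eq | inj₁ f₀→f₁ = suc p , q , cong suc p+q≡k , (begin
      (toℕ (f (fromℕ (suc k))) + q) % n  ≡⟨ eq ⟩
      (toℕ (f (suc zero)) + p) % n       ≡⟨ %-+-congʳ p (Next⇒% f₀→f₁) ⟩
      (suc (toℕ (f zero)) + p) % n       ≡⟨ cong (_% n) (ℕ.+-suc (toℕ (f zero)) p) ⟨
      (toℕ (f zero) + suc p) % n         ∎)
      where open ≡-Reasoning
    ... | p , q , p+q≡k , eq | inj₂ f₁→f₀ = p , suc q , trans (ℕ.+-suc p q) (cong suc p+q≡k) , (begin
      (toℕ (f (fromℕ (suc k))) + suc q) % n    ≡⟨ cong (_% n) (ℕ.+-suc (toℕ (f (fromℕ (suc k)))) q) ⟩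
      suc (toℕ (f (fromℕ (suc k))) + q) % n    ≡⟨ %-+-congˡ 1 eq ⟩
      suc (toℕ (f (suc zero)) + p) % n         ≡⟨ %-+-congʳ p (Next⇒% f₁→f₀) ⟨
      (toℕ (f zero) + p) % n                   ∎)
      where open ≡-Reasoning

    -- The two arcs between the vertices have lengths `j` and `n - j`, so non-adjacency in the power
    -- makes both exceed `r`. Conversely, a path of length at most `r` has too small a net
    -- displacement to reach a vertex that far away.
    power-complement-Adj : ∀ {r} (x : Fin n) {j} → j < n →
      Graph.Adj (complement (power (cycle n n≥3) r)) x ((toℕ x + j) mod n) ⇔ (r < j × r + j < n)
    power-complement-Adj {r} x {j} j<n = mk⇔ to from
      where
      y = (toℕ x + j) mod n

      to : Graph.Adj (complement (power (cycle n n≥3) r)) x y → r < j × r + j < n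
      to (x≢y , ¬near) = r<j , ℕ.≰⇒> λ n≤r+j →
        ¬path (n ∸ j) (ℕ.m≤n+o⇒m∸n≤o n j (subst (n ≤_) (ℕ.+-comm r j) n≤r+j)) (reverse back)
        where
        ¬path : ∀ k → k ≤ r → ¬ Path (cycle n n≥3) x y k
        ¬path k k≤r p = let d , d≤k , s = shortest-path _ k p in
          ¬near (x≢y , d , ℕ.≤-trans d≤k k≤r , s)
        r<j : r < j
        r<j = ℕ.≰⇒> λ j≤r → ¬path j j≤r (arc x j<n)
        y+[n∸j]≡x : (toℕ y + (n ∸ j)) mod n ≡ x
        y+[n∸j]≡x = trans (%⇒mod (begin
          (toℕ y + (n ∸ j)) % n        ≡⟨ %-+-congʳ (n ∸ j) (toℕ-mod-% (toℕ x + j)) ⟩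
          (toℕ x + j + (n ∸ j)) % n    ≡⟨ cong (_% n) (ℕ.+-assoc (toℕ x) j (n ∸ j)) ⟩
          (toℕ x + (j + (n ∸ j))) % n  ≡⟨ cong (λ z → (toℕ x + z) % n) (ℕ.m+[n∸m]≡n (ℕ.<⇒≤ j<n)) ⟩
          (toℕ x + n) % n              ≡⟨ [m+n]%n≡m%n (toℕ x) n ⟩
          toℕ x % n                    ∎)) (mod-toℕ x)
          where open ≡-Reasoning
        -- The other arc runs forward from `y` to `x`; its length is below `n` because `r < j` makes
        -- `j` positive.
        back : Path (cycle n n≥3) y x (n ∸ j)
        back = subst (λ z → Path (cycle n n≥3) y z (n ∸ j)) y+[n∸j]≡x
          (arc y (ℕ.∸-monoʳ-< (ℕ.≤-<-trans z≤n r<j) (ℕ.<⇒≤ j<n)))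

      from : r < j × r + j < n → Graph.Adj (complement (power (cycle n n≥3) r)) x y
      from (r<j , r+j<n) =
        -- Equality of the vertices is treated as a walk with no steps in either direction.
        (λ x≡y → no-displacement 0 0 z≤n (cong (λ z → (toℕ z + 0) % n) (sym x≡y))) ,
        λ { (_ , d , d≤r , path , _) →
          let open Path path
              p , q , p+q≡d , eq = walk-displacement d vertex step
          in no-displacement p q (subst (_≤ r) (sym p+q≡d) d≤r)
               (subst₂ (λ u v → (toℕ u + q) % n ≡ (toℕ v + p) % n) end start eq) }
        where
        -- Cancelling `toℕ x` leaves `j + q` congruent to `p`. Both are below `n`, hence equal, and
        -- then `j ≤ p ≤ r` contradicts `r < j`.
        no-displacement : ∀ p q → p + q ≤ r → ¬ (toℕ y + q) % n ≡ (toℕ x + p) % n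
        no-displacement p q p+q≤r eq =
          ℕ.<⇒≱ r<j (ℕ.≤-trans (ℕ.m≤m+n j q) (subst (_≤ r) (sym j+q≡p) p≤r))
          where
          open ≡-Reasoning
          p≤r = ℕ.≤-trans (ℕ.m≤m+n p q) p+q≤r
          q≤r = ℕ.≤-trans (ℕ.m≤n+m q p) p+q≤r
          j+q≡p : j + q ≡ p
          j+q≡p = %-injective
            (ℕ.≤-<-trans (subst (_≤ r + j) (ℕ.+-comm q j) (ℕ.+-monoˡ-≤ j q≤r)) r+j<n)
            (ℕ.≤-<-trans (ℕ.≤-trans p≤r (ℕ.m≤m+n r j)) r+j<n)
            (%-+-cancelˡ (toℕ x) (begin
              (toℕ x + (j + q)) % n  ≡⟨ cong (_% n) (ℕ.+-assoc (toℕ x) j q) ⟨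
              (toℕ x + j + q) % n    ≡⟨ %-+-congʳ q (toℕ-mod-% (toℕ x + j)) ⟨
              (toℕ y + q) % n        ≡⟨ eq ⟩
              (toℕ x + p) % n        ∎))

-- Symmetry of adjacency matrices, Bézout coefficients and divisibility.

adjacencyMatrix-symmetric : ∀ {n} (G : Graph n) x y → adjacencyMatrix G x y ≡ adjacencyMatrix G y x
adjacencyMatrix-symmetric G x y = indicator-⇔ (mk⇔ symm symm) (adj? x y) (adj? y x)
  where open Graph G

-- Bézout's identity over ℕ puts the `1` on either side. On the wrong side it yields an inverse of
-- `-1` instead of `1`, which squaring repairs.
coprime⇒inverse : ∀ {m n} → 1 < n → Coprime m n → ∃[ a ] ∃[ b ] a * m ≡ suc (b * n)
coprime⇒inverse {m} {n} 1<n m⊥n with coprime-Bézout m⊥n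
... | Bézout.+- x y 1+yn≡xm = x , y , sym 1+yn≡xm
... | Bézout.-+ x y 1+xm≡yn = square (x * m) refl
  where
  square : ∀ u → x * m ≡ u → ∃[ a ] ∃[ b ] a * m ≡ suc (b * n)
  -- Here `1 ≡ y * n`, so `n` would be `1`.
  square zero xm≡0 = contradiction
    (∣1⇒≡1 (divides y (trans (cong suc (sym xm≡0)) 1+xm≡yn))) (ℕ.>⇒≢ 1<n)
  -- u ≡ -1 modulo n, hence u * u ≡ 1.
  square (suc w) xm≡1+w = suc w * x , w * y , (begin
    suc w * x * m            ≡⟨ ℕ.*-assoc (suc w) x m ⟩
    suc w * (x * m)          ≡⟨ cong (suc w *_) xm≡1+w ⟩
    suc w * suc w            ≡⟨⟩
    suc (w + w * suc w)      ≡⟨ cong suc (ℕ.*-suc w (suc w)) ⟨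
    suc (w * suc (suc w))    ≡⟨ cong (λ z → suc (w * suc z)) xm≡1+w ⟨
    suc (w * suc (x * m))    ≡⟨ cong (λ z → suc (w * z)) 1+xm≡yn ⟩
    suc (w * (y * n))        ≡⟨ cong suc (ℕ.*-assoc w y n) ⟨
    suc (w * y * n)          ∎)
    where open ≡-Reasoning

1-indicator≡0⇒ : ∀ {P : Set} (P? : Dec P) → 1ℚ -ℚ indicator P? ≡ 0ℚ → P
1-indicator≡0⇒ (yes p) _ = p

∣-periodic : ∀ {d n} → d ∣ n → Periodic n λ i → indicator (d ∣? i)
∣-periodic {d} {n} d∣n i = indicator-⇔
  (mk⇔ (λ d∣i+n → ∣m+n∣m⇒∣n (subst (d ∣_) (ℕ.+-comm i n) d∣i+n) d∣n) (λ d∣i → ∣m∣n⇒∣m+n d∣i d∣n))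
  (d ∣? (i + n)) (d ∣? i)

-- Point masses on residue classes.

module _ {n : ℕ} .{{_ : NonZero n}} where

  -- The identity matrix extended periodically to ℕ in both arguments, so that indices can be
  -- shifted without wrapping around.
  δ : ℕ → ℕ → ℚ
  δ u v = indicator (u % n ℕ.≟ v % n)

  δ-cong : ∀ {u v w} → u % n ≡ v % n → δ u w ≡ δ v w
  δ-cong {w = w} u≡v = cong (λ z → indicator (z ℕ.≟ w % n)) u≡v

  δ-periodic : ∀ w → Periodic n λ u → δ u w
  δ-periodic w u = δ-cong ([m+n]%n≡m%n u n)

  δ-+-cancelʳ : ∀ u v k → δ (u + k) (v + k) ≡ δ u v
  δ-+-cancelʳ u v k = indicator-⇔
    (mk⇔ (%-+-cancelˡ k ∘ subst₂ (λ s t → s % n ≡ t % n) (ℕ.+-comm u k) (ℕ.+-comm v k)) (%-+-congʳ k))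
    ((u + k) % n ℕ.≟ (v + k) % n) (u % n ℕ.≟ v % n)

  δ-toℕ : ∀ (x y : Fin n) → δ (toℕ x) (toℕ y) ≡ identity x y
  δ-toℕ x y = indicator-⇔
    (mk⇔ (toℕ-injective ∘ %-injective (toℕ<n x) (toℕ<n y)) (cong (λ z → toℕ z % n)))
    (toℕ x % n ℕ.≟ toℕ y % n) (x Fin.≟ y)

  ∑<-δ : ∀ (y : Fin n) → (∑< n λ u → δ u (toℕ y)) ≡ 1ℚ
  ∑<-δ y = trans (sum-cong-≗ λ x → begin
    δ (toℕ x) (toℕ y)    ≡⟨ δ-toℕ x y ⟩
    identity x y         ≡⟨ identity-symmetric x y ⟩
    identity y x         ≡⟨ ℚ.*-identityʳ (identity y x) ⟨
    identity y x *ℚ 1ℚ   ∎) (identity-∙ (λ _ → 1ℚ) y)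
    where open ≡-Reasoning

  -- The term at `0` is the identity entry; the other `b * n` terms form `b` full periods, each
  -- meeting the class of `y` exactly once.
  ∑<-δ-1+bn : ∀ b (x y : Fin n) →
    (∑< (suc (b * n)) λ s → δ (toℕ x + s) (toℕ y)) ≡ identity x y +ℚ b ×ℚ 1ℚ
  ∑<-δ-1+bn b x y = cong₂ _+ℚ_
    (trans (cong (λ u → δ u (toℕ y)) (ℕ.+-identityʳ (toℕ x))) (δ-toℕ x y))
    (begin
      (∑< (b * n) λ s → δ (toℕ x + suc s) (toℕ y))
        ≡⟨ ∑<-blocks b n (λ s → δ (toℕ x + suc s) (toℕ y)) ⟩
      (∑< b λ t → ∑< n λ i → δ (toℕ x + suc (i + t * n)) (toℕ y))
        ≡⟨ ∑<-cong b (λ {t} _ → period t) ⟩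
      (∑< b λ _ → 1ℚ)
        ≡⟨ sum-replicate b ⟩
      b ×ℚ 1ℚ ∎)
    where
    open ≡-Reasoning
    period : ∀ t → (∑< n λ i → δ (toℕ x + suc (i + t * n)) (toℕ y)) ≡ 1ℚ
    period t = begin
      (∑< n λ i → δ (toℕ x + suc (i + t * n)) (toℕ y))
        ≡⟨ ∑<-cong n (λ {i} _ → δ-cong {w = toℕ y} (trans
             (cong (_% n) (trans (ℕ.+-suc (toℕ x) (i + t * n)) (cong suc (sym (ℕ.+-assoc (toℕ x) i (t * n))))))
             ([m+kn]%n≡m%n (suc (toℕ x) + i) t n))) ⟩
      (∑< n λ i → δ (suc (toℕ x) + i) (toℕ y))
        ≡⟨ ∑<-shift (δ-periodic (toℕ y)) (suc (toℕ x)) ⟩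
      (∑< n λ u → δ u (toℕ y))
        ≡⟨ ∑<-δ y ⟩
      1ℚ ∎

  -- The adjacency matrix as a window sum, its kernel and its inverse.

  module _ (n≥3 : 3 ≤ n) {r m : ℕ} (n≡1+r+[m+r] : n ≡ suc r + (m + r)) where

    G : Graph n
    G = complement (power (cycle n n≥3) r)

    A : Matrix n
    A = adjacencyMatrix G

    A-∙-periodic : ∀ {g} → Periodic n g → ∀ x →
      (A ∙ (g ∘ toℕ)) x ≡ ∑< m λ i → g (toℕ x + (suc r + i))
    A-∙-periodic {g} g-periodic x = begin
      sum (λ k → A x k *ℚ g (toℕ k))
        -- Reading the column index through `mod` extends the summand to a periodic function on ℕ,
        -- which can then be recentred at `x`.
        ≡⟨ sum-cong-≗ (λ k → cong (λ y → A x y *ℚ g (toℕ k)) (mod-toℕ k)) ⟨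
      ∑< n F
        ≡⟨ ∑<-shift F-periodic (toℕ x) ⟨
      ∑< n (F ∘ (toℕ x +_))
        ≡⟨ ∑<-cong n {F ∘ (toℕ x +_)} {H} (λ {j} j<n → cong (_*ℚ g (toℕ x + j))
             (indicator-⇔ (power-complement-Adj n≥3 x j<n) (Graph.adj? G x ((toℕ x + j) mod n)) (far? j))) ⟩
      ∑< n H
        -- The differences fall into three runs: `0` to `r` are near going forward, the next `m` are
        -- far, and the last `r` are near going backward.
        ≡⟨ cong (λ k → ∑< k H) n≡1+r+[m+r] ⟩
      ∑< (suc r + (m + r)) H
        ≡⟨ ∑<-split (suc r) (m + r) H ⟩
      ∑< (suc r) H +ℚ ∑< (m + r) (H ∘ (suc r +_))
        ≡⟨ cong₂ _+ℚ_ (∑<-zero (suc r) near) (∑<-split m r (H ∘ (suc r +_))) ⟩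
      0ℚ +ℚ (∑< m (H ∘ (suc r +_)) +ℚ ∑< r (H ∘ (suc r +_) ∘ (m +_)))
        ≡⟨ ℚ.+-identityˡ _ ⟩
      ∑< m (H ∘ (suc r +_)) +ℚ ∑< r (H ∘ (suc r +_) ∘ (m +_))
        ≡⟨ cong₂ _+ℚ_ (∑<-cong m middle) (∑<-zero r (λ {i} _ → wrapped i)) ⟩
      (∑< m λ i → g (toℕ x + (suc r + i))) +ℚ 0ℚ
        ≡⟨ ℚ.+-identityʳ _ ⟩
      (∑< m λ i → g (toℕ x + (suc r + i))) ∎
      where
      open ≡-Reasoning
      far? : ∀ j → Dec (r < j × r + j < n)
      far? j = (r ℕ.<? j) ×-dec (r + j ℕ.<? n)
      F H : ℕ → ℚ
      F i = A x (i mod n) *ℚ g i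
      H j = indicator (far? j) *ℚ g (toℕ x + j)
      F-periodic : Periodic n F
      F-periodic i = cong₂ (λ y q → A x y *ℚ q) (%⇒mod ([m+n]%n≡m%n i n)) (g-periodic i)
      H-zero : ∀ j → ¬ (r < j × r + j < n) → H j ≡ 0ℚ
      H-zero j ¬far = trans (cong (_*ℚ g (toℕ x + j)) (indicator-false (far? j) ¬far)) (ℚ.*-zeroˡ (g (toℕ x + j)))
      near : ∀ {j} → j < suc r → H j ≡ 0ℚ
      near {j} (s≤s j≤r) = H-zero j λ (r<j , _) → ℕ.<⇒≱ r<j j≤r
      middle : ∀ {i} → i < m → H (suc r + i) ≡ g (toℕ x + (suc r + i))
      middle {i} i<m = trans
        (cong (_*ℚ g (toℕ x + (suc r + i))) (indicator-true (far? (suc r + i)) (ℕ.m≤m+n (suc r) i ,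
          subst₂ _<_ (trans (cong (suc r +_) (ℕ.+-comm i r)) (x∙yz≈y∙xz (suc r) r i)) (sym n≡1+r+[m+r])
            (ℕ.+-monoʳ-< (suc r) (ℕ.+-monoˡ-< r i<m)))))
        (ℚ.*-identityˡ (g (toℕ x + (suc r + i))))
      wrapped : ∀ i → H (suc r + (m + i)) ≡ 0ℚ
      wrapped i = H-zero (suc r + (m + i)) λ (_ , r+j<n) → ℕ.<⇒≱ r+j<n
        (subst₂ _≤_ (sym n≡1+r+[m+r]) (x∙yz≈y∙xz (suc r) r (m + i))
          (ℕ.+-monoʳ-≤ (suc r) (subst (_≤ r + (m + i)) (ℕ.+-comm r m) (ℕ.+-monoʳ-≤ r (ℕ.m≤m+n m i)))))

    -- Period `n` of `χ` lets `A` act on `v` by window sums; period `m` makes the two ends of the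
    -- telescoped sum cancel.
    nonSingular⇒common-divisor≡1 : ∀ {d} → d ∣ n → d ∣ m → NonSingular A → d ≡ 1
    nonSingular⇒common-divisor≡1 {d} d∣n d∣m (B , _ , BA≋I) = ∣1⇒≡1 (1-indicator≡0⇒ (d ∣? 1) (begin
      1ℚ -ℚ χ 1           ≡⟨ cong (_-ℚ χ 1) (indicator-true (d ∣? 0) (d ∣0)) ⟨
      -- `n` is not syntactically a successor, so vertex 0 is obtained as `0 mod n`.
      v 0                 ≡⟨ cong v (trans (toℕ-mod 0) (m*n%n≡0 0 n)) ⟨
      v (toℕ (0 mod n))   ≡⟨ left-inverse⇒trivial-kernel {A = A} {B} BA≋I {v ∘ toℕ} Av≡0 (0 mod n) ⟩
      0ℚ                  ∎))
      where
      open ≡-Reasoning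
      χ v : ℕ → ℚ
      χ i = indicator (d ∣? i)
      v i = χ i -ℚ χ (suc i)
      Av≡0 : ∀ x → (A ∙ (v ∘ toℕ)) x ≡ 0ℚ
      Av≡0 x = begin
        (A ∙ (v ∘ toℕ)) x
          ≡⟨ A-∙-periodic (λ i → cong₂ _-ℚ_ (∣-periodic d∣n i) (∣-periodic d∣n (suc i))) x ⟩
        (∑< m λ i → v (toℕ x + (suc r + i)))
          ≡⟨ ∑<-cong m (λ {i} _ → cong₂ (λ k l → χ k -ℚ χ l)
               (sym (ℕ.+-assoc (toℕ x) (suc r) i))
               (trans (cong suc (sym (ℕ.+-assoc (toℕ x) (suc r) i))) (sym (ℕ.+-suc c i)))) ⟩
        (∑< m λ i → χ (c + i) -ℚ χ (c + suc i))
          ≡⟨ ∑<-telescope m (χ ∘ (c +_)) ⟩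
        χ (c + 0) -ℚ χ (c + m)
          ≡⟨ cong₂ _-ℚ_ (cong χ (ℕ.+-identityʳ c)) (∣-periodic d∣m c) ⟩
        χ c -ℚ χ c
          ≡⟨ ℚ.+-inverseʳ (χ c) ⟩
        0ℚ ∎
        where c = toℕ x + suc r

    coprime⇒nonSingular : .{{_ : NonZero m}} → Coprime m n → NonSingular A
    coprime⇒nonSingular m⊥n =
      let a , b , am≡1+bn = coprime⇒inverse (ℕ.≤-trans (s≤s (s≤s z≤n)) n≥3) m⊥n
          c , mc≡-b       = ×ℚ-divisible m (-ℚ (b ×ℚ 1ℚ))
      in symmetric∧right-inverse⇒nonSingular {A = A} {λ x y → column a b c am≡1+bn mc≡-b y (toℕ x)}
           (adjacencyMatrix-symmetric G)
           λ x y → right-inverse a b c am≡1+bn mc≡-b y x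
      where
      open ≡-Reasoning
      module _ (a b : ℕ) (c : ℚ) (am≡1+bn : a * m ≡ suc (b * n))
               (mc≡-b : m ×ℚ c ≡ -ℚ (b ×ℚ 1ℚ)) (y : Fin n) where
        -- Windows start `suc r` past their base point, so the masses are centred at `toℕ y + suc r`
        -- for this offset to cancel.
        β : ℕ → ℕ → ℚ
        β u t = δ (u + t * m) (toℕ y + suc r)
        column : ℕ → ℚ
        column z = (∑< a (β z)) +ℚ c
        column-periodic : Periodic n column
        column-periodic z = cong (_+ℚ c) (∑<-cong a λ {t} _ →
          trans (cong (λ u → δ u (toℕ y + suc r)) (xy∙z≈xz∙y z n (t * m)))
            (δ-periodic (toℕ y + suc r) (z + t * m)))
        right-inverse : ∀ x → (A ∙ (column ∘ toℕ)) x ≡ identity x y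
        right-inverse x = begin
          (A ∙ (column ∘ toℕ)) x
            ≡⟨ A-∙-periodic column-periodic x ⟩
          (∑< m λ i → (∑< a (β (toℕ x + (suc r + i)))) +ℚ c)
            ≡⟨ ∑-distrib-+ {m} (λ i → ∑< a (β (toℕ x + (suc r + toℕ i)))) (λ _ → c) ⟩
          (∑< m λ i → ∑< a (β (toℕ x + (suc r + i)))) +ℚ (∑< m λ _ → c)
            ≡⟨ cong₂ _+ℚ_ (∑<-comm m a λ i → β (toℕ x + (suc r + i))) (trans (sum-replicate m) mc≡-b) ⟩
          (∑< a λ t → ∑< m λ i → β (toℕ x + (suc r + i)) t) -ℚ b ×ℚ 1ℚ
            ≡⟨ cong (_-ℚ b ×ℚ 1ℚ) (∑<-cong a λ {t} _ → ∑<-cong m λ {i} _ → cancel i t) ⟩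
          (∑< a λ t → ∑< m λ i → δ (toℕ x + (i + t * m)) (toℕ y)) -ℚ b ×ℚ 1ℚ
            -- The `a` windows of length `m` lie end to end and merge into a single one of length
            -- `a * m`.
            ≡⟨ cong (_-ℚ b ×ℚ 1ℚ) (∑<-blocks a m λ s → δ (toℕ x + s) (toℕ y)) ⟨
          (∑< (a * m) λ s → δ (toℕ x + s) (toℕ y)) -ℚ b ×ℚ 1ℚ
            ≡⟨ cong (λ k → (∑< k λ s → δ (toℕ x + s) (toℕ y)) -ℚ b ×ℚ 1ℚ) am≡1+bn ⟩
          (∑< (suc (b * n)) λ s → δ (toℕ x + s) (toℕ y)) -ℚ b ×ℚ 1ℚ
            ≡⟨ cong (_-ℚ b ×ℚ 1ℚ) (∑<-δ-1+bn b x y) ⟩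
          identity x y +ℚ b ×ℚ 1ℚ -ℚ b ×ℚ 1ℚ
            ≡⟨ ℚ.+-assoc (identity x y) (b ×ℚ 1ℚ) (-ℚ (b ×ℚ 1ℚ)) ⟩
          identity x y +ℚ (b ×ℚ 1ℚ -ℚ b ×ℚ 1ℚ)
            ≡⟨ cong (identity x y +ℚ_) (ℚ.+-inverseʳ (b ×ℚ 1ℚ)) ⟩
          identity x y +ℚ 0ℚ
            ≡⟨ ℚ.+-identityʳ (identity x y) ⟩
          identity x y ∎
          where
          cancel : ∀ i t → β (toℕ x + (suc r + i)) t ≡ δ (toℕ x + (i + t * m)) (toℕ y)
          cancel i t = trans (cong (λ u → δ u (toℕ y + suc r)) (begin
            toℕ x + (suc r + i) + t * m    ≡⟨ ℕ.+-assoc (toℕ x) (suc r + i) (t * m) ⟩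
            toℕ x + (suc r + i + t * m)    ≡⟨ cong (toℕ x +_) (ℕ.+-assoc (suc r) i (t * m)) ⟩
            toℕ x + (suc r + (i + t * m))  ≡⟨ cong (toℕ x +_) (ℕ.+-comm (suc r) (i + t * m)) ⟩
            toℕ x + (i + t * m + suc r)    ≡⟨ ℕ.+-assoc (toℕ x) (i + t * m) (suc r) ⟨
            toℕ x + (i + t * m) + suc r    ∎))
            (δ-+-cancelʳ (toℕ x + (i + t * m)) (toℕ y) (suc r))

corollary18 : ∀ (n r : ℕ) (n≥3 : 3 ≤ n) → 1 ≤ r → r < ⌊ n /2⌋ →
    NonSingularGraph (complement (power (cycle n n≥3) r)) ⇔ gcd n (2 * r + 1) ≡ 1
corollary18 n r n≥3 _ r<⌊n/2⌋ = mk⇔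
  (nonSingular⇒common-divisor≡1 n≥3 n≡ (gcd[m,n]∣m n (2 * r + 1)) gcd∣m)
  (λ gcd≡1 → coprime⇒nonSingular n≥3 n≡ λ (d∣m , d∣n) →
    gcd≡1⇒coprime gcd≡1 (d∣n , ∣m+n∣m⇒∣n (subst (_ ∣_) n≡m+[2r+1] d∣n) d∣m))
  where
  instance
    n-nonZero : NonZero n
    n-nonZero = >-nonZero (ℕ.≤-trans (s≤s z≤n) n≥3)
  2+2r≤n : suc r + suc r ≤ n
  2+2r≤n = subst (suc r + suc r ≤_) (ℕ.⌊n/2⌋+⌈n/2⌉≡n n)
    (ℕ.+-mono-≤ r<⌊n/2⌋ (ℕ.≤-trans r<⌊n/2⌋ (ℕ.⌊n/2⌋≤⌈n/2⌉ n)))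
  k = proj₁ (ℕ.m≤n⇒∃[o]m+o≡n 2+2r≤n)
  -- The bound on `r` gives `2r + 2 ≤ n`, so `m = n - (2r + 1)` is positive and the inverse can
  -- divide by it.
  m = suc k
  n≡ : n ≡ suc r + (m + r)
  n≡ = begin
    n                      ≡⟨ proj₂ (ℕ.m≤n⇒∃[o]m+o≡n 2+2r≤n) ⟨
    suc r + suc r + k      ≡⟨ ℕ.+-assoc (suc r) (suc r) k ⟩
    suc r + suc (r + k)    ≡⟨ cong (λ z → suc r + suc z) (ℕ.+-comm r k) ⟩
    suc r + (m + r)        ∎
    where open ≡-Reasoning
  -- By this equation `n` and `m` have the same common divisors as `n` and `2 * r + 1`.
  n≡m+[2r+1] : n ≡ m + (2 * r + 1)
  n≡m+[2r+1] = begin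
    n                    ≡⟨ n≡ ⟩
    suc r + (m + r)      ≡⟨ x∙yz≈y∙xz (suc r) m r ⟩
    m + suc (r + r)      ≡⟨ cong (λ z → m + suc (r + z)) (ℕ.+-identityʳ r) ⟨
    m + suc (2 * r)      ≡⟨ cong (m +_) (ℕ.+-comm 1 (2 * r)) ⟩
    m + (2 * r + 1)      ∎
    where open ≡-Reasoning
  gcd∣m : gcd n (2 * r + 1) ∣ m
  gcd∣m = ∣m+n∣m⇒∣n
    (subst (gcd n (2 * r + 1) ∣_) (trans n≡m+[2r+1] (ℕ.+-comm m (2 * r + 1))) (gcd[m,n]∣m n (2 * r + 1)))
    (gcd[m,n]∣n n (2 * r + 1))
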